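{- For all integers $n\ge 3$ and $1<k<n$, the girth of $G=H_B(n,k)$ is $4$.
   Context: Fix integers $n\ge 2$ and $1\le k<n$ and positive real numbers $x_1<x_2<\dots<x_n$. Let $\mathscr{B}_n=\{\pm x_1,\pm x_2,\dots,\pm x_{n-1},x_n\}$ (so $-x_n\notin\mathscr{B}_n$). Let $\phi(\mathscr{B}_n)$ be the family of all nonempty subsets $S\subseteq\mathscr{B}_n$ whose elements have pairwise distinct absolute values and whose element of largest absolute value is positive. Let $\mathscr{B}_n^+=\{x_1,\dots,x_n\}$, let $V_1$ be the set of all $k$-element subsets of $\mathscr{B}_n^+$, and let $V_2=\phi(\mathscr{B}_n)\setminus V_1$. For $A\in\phi(\mathscr{B}_n)$ put $A^\dagger=\{|a|:a\in A\}$. The bipartite Kneser B type-$k$ graph $H_B(n,k)$ is the simple graph with vertex set $V_1\cup V_2$ in which $X\in V_1$ and $Y\in V_2$ are adjacent if and only if $X\subseteq Y^\dagger$ or $Y^\dagger\subseteq X$, and there are no other edges. The girth is the length of a shortest cycle. -}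

module Defs where

open import Level using (Level; 0ℓ; suc; _⊔_)
open import Data.Empty using (⊥)
open import Data.Fin using (Fin; zero; toℕ; fromℕ; inject₁) renaming (suc to fsuc)
open import Data.List using (List; length; map)
open import Data.Nat using (ℕ)
import Data.Nat as ℕ
open import Data.Product using (Σ; ∃; ∃-syntax; _×_; _,_)
open import Data.Rational using (ℚ; 0ℚ; 1ℚ; -_; _<_; _≤_) renaming (_⊔_ to _⊔ℚ_; _+_ to _+ℚ_)
open import Data.Rational.Properties
open import Data.Sum using (_⊎_; inj₁; inj₂; swap)
open import Function using (_∘_; id)
open import Function.Definitions using (Injective)
open import Relation.Binary using (tri<; tri≈; tri>; Setoid; Rel; Symmetric; Irreflexive; _Respects₂_)
open import Relation.Binary.PropositionalEquality using (_≡_; refl; sym; subst)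
open import Relation.Nullary using (¬_; contradiction)

------------------------------------------------------------------------
-- Dedekind reals: L is the set of rationals below the number, U the set
-- of rationals above it.

record ℝ : Set₁ where
  field
    L U         : ℚ → Set
    L-inhabited : ∃ L
    U-inhabited : ∃ U
    L-closed    : ∀ {p q} → p ≤ q → L q → L p
    U-closed    : ∀ {p q} → p ≤ q → U p → U q
    L-open      : ∀ {p} → L p → ∃[ q ] p < q × L q
    U-open      : ∀ {q} → U q → ∃[ p ] p < q × U p
    disjoint    : ∀ {q} → L q → U q → ⊥
    located     : ∀ {p q} → p < q → L p ⊎ U q

open ℝ

infix 4 _≤ℝ_ _<ℝ_ _≈ℝ_

record _≤ℝ_ (a b : ℝ) : Set where
  constructor mk≤
  field
    L⊆L : ∀ {q} → L a q → L b q

open _≤ℝ_ public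

_<ℝ_ : ℝ → ℝ → Set
a <ℝ b = ∃[ q ] U a q × L b q

record _≈ℝ_ (a b : ℝ) : Set where
  constructor antisym
  field
    ≈⇒≤ : a ≤ℝ b
    ≈⇒≥ : b ≤ℝ a

open _≈ℝ_ public

≤ℝ-refl : ∀ {a} → a ≤ℝ a
≤ℝ-refl = mk≤ id

≤ℝ-trans : ∀ {a b c} → a ≤ℝ b → b ≤ℝ c → a ≤ℝ c
≤ℝ-trans (mk≤ f) (mk≤ g) = mk≤ (g ∘ f)

ℝ-setoid : Setoid (suc 0ℓ) 0ℓ
ℝ-setoid = record
  { Carrier       = ℝ
  ; _≈_           = _≈ℝ_
  ; isEquivalence = record
    { refl  = antisym ≤ℝ-refl ≤ℝ-refl
    ; sym   = λ (antisym p q) → antisym q p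
    ; trans = λ (antisym p q) (antisym r s) → antisym (≤ℝ-trans p r) (≤ℝ-trans s q)
    }
  }

U-antitone : ∀ {a b} → a ≤ℝ b → ∀ {q} → U b q → U a q
U-antitone {a} {b} a≤b Ubq with U-open b Ubq
... | p , p<q , Ubp with located a p<q
...   | inj₁ Lap = contradiction Ubp (disjoint b (L⊆L a≤b Lap))
...   | inj₂ Uaq = Uaq

private
  open import Algebra.Properties.Group +-0-group using ()
    renaming (⁻¹-involutive to -‿involutive)

  below : ∀ q → ∃[ p ] p < q
  below q = q +ℚ - 1ℚ , subst (q +ℚ - 1ℚ <_) (+-identityʳ q) (+-monoʳ-< q (negative⁻¹ (- 1ℚ)))

  above : ∀ q → ∃[ p ] q < p
  above q = q +ℚ 1ℚ , subst (_< q +ℚ 1ℚ) (+-identityʳ q) (+-monoʳ-< q (positive⁻¹ 1ℚ))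

  ⊔ℚ-lub-< : ∀ {p q r} → p < r → q < r → p ⊔ℚ q < r
  ⊔ℚ-lub-< {p} {q} {r} p<r q<r with ⊔-sel p q
  ... | inj₁ e = subst (_< r) (sym e) p<r
  ... | inj₂ e = subst (_< r) (sym e) q<r

fromℚ : ℚ → ℝ
fromℚ r = record
  { L           = _< r
  ; U           = r <_
  ; L-inhabited = below r
  ; U-inhabited = above r
  ; L-closed    = ≤-<-trans
  ; U-closed    = λ p≤q r<p → <-≤-trans r<p p≤q
  ; L-open      = <-dense
  ; U-open      = λ r<q → let (p , r<p , p<q) = <-dense r<q in p , p<q , r<p
  ; disjoint    = <-asym
  ; located     = loc
  }
  where
  loc : ∀ {p q} → p < q → p < r ⊎ r < q
  loc {p} {q} p<q with ≤-total r p
  ... | inj₁ r≤p = inj₂ (≤-<-trans r≤p p<q)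
  ... | inj₂ p≤r with <-cmp p r
  ...   | tri< p<r _ _  = inj₁ p<r
  ...   | tri≈ _ refl _ = inj₂ p<q
  ...   | tri> _ _ r<p  = inj₂ (<-trans r<p p<q)

0ℝ : ℝ
0ℝ = fromℚ 0ℚ

infix 8 -ℝ_

-ℝ_ : ℝ → ℝ
-ℝ a = record
  { L           = λ q → U a (- q)
  ; U           = λ q → L a (- q)
  ; L-inhabited = let (q , Uq) = U-inhabited a in - q , subst (U a) (sym (-‿involutive q)) Uq
  ; U-inhabited = let (q , Lq) = L-inhabited a in - q , subst (L a) (sym (-‿involutive q)) Lq
  ; L-closed    = λ p≤q → U-closed a (neg-antimono-≤ p≤q)
  ; U-closed    = λ p≤q → L-closed a (neg-antimono-≤ p≤q)
  ; L-open      = λ {p} Up → let (q , q<-p , Uq) = U-open a Up in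
                    - q , subst (_< - q) (-‿involutive p) (neg-antimono-< q<-p)
                        , subst (U a) (sym (-‿involutive q)) Uq
  ; U-open      = λ {p} Lp → let (q , -p<q , Lq) = L-open a Lp in
                    - q , subst (- q <_) (-‿involutive p) (neg-antimono-< -p<q)
                        , subst (L a) (sym (-‿involutive q)) Lq
  ; disjoint    = λ Uq Lq → disjoint a Lq Uq
  ; located     = λ p<q → swap (located a (neg-antimono-< p<q))
  }

infixl 6 _⊔ℝ_

_⊔ℝ_ : ℝ → ℝ → ℝ
a ⊔ℝ b = record
  { L           = λ q → L a q ⊎ L b q
  ; U           = λ q → U a q × U b q
  ; L-inhabited = let (q , Lq) = L-inhabited a in q , inj₁ Lq
  ; U-inhabited = let (p , Up) = U-inhabited a
                      (q , Uq) = U-inhabited b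
                  in p ⊔ℚ q , U-closed a (p≤p⊔q p q) Up , U-closed b (p≤q⊔p p q) Uq
  ; L-closed    = λ where p≤q (inj₁ Lq) → inj₁ (L-closed a p≤q Lq)
                          p≤q (inj₂ Lq) → inj₂ (L-closed b p≤q Lq)
  ; U-closed    = λ p≤q (Ua , Ub) → U-closed a p≤q Ua , U-closed b p≤q Ub
  ; L-open      = λ where (inj₁ Lp) → let (q , p<q , Lq) = L-open a Lp in q , p<q , inj₁ Lq
                          (inj₂ Lp) → let (q , p<q , Lq) = L-open b Lp in q , p<q , inj₂ Lq
  ; U-open      = λ (Ua , Ub) →
                    let (p , p<r , Up) = U-open a Ua
                        (q , q<r , Uq) = U-open b Ub
                    in p ⊔ℚ q , ⊔ℚ-lub-< p<r q<r
                     , U-closed a (p≤p⊔q p q) Up , U-closed b (p≤q⊔p p q) Uq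
  ; disjoint    = λ where (inj₁ Lq) (Uq , _) → disjoint a Lq Uq
                          (inj₂ Lq) (_ , Uq) → disjoint b Lq Uq
  ; located     = loc
  }
  where
  loc : ∀ {p q} → p < q → (L a p ⊎ L b p) ⊎ (U a q × U b q)
  loc p<q with located a p<q | located b p<q
  ... | inj₁ La | _       = inj₁ (inj₁ La)
  ... | inj₂ _  | inj₁ Lb = inj₁ (inj₂ Lb)
  ... | inj₂ Ua | inj₂ Ub = inj₂ (Ua , Ub)

∣_∣ℝ : ℝ → ℝ
∣ a ∣ℝ = a ⊔ℝ -ℝ a

∣∣ℝ-cong : ∀ {a b} → a ≈ℝ b → ∣ a ∣ℝ ≈ℝ ∣ b ∣ℝ
∣∣ℝ-cong (antisym a≤b b≤a) = antisym (mono a≤b b≤a) (mono b≤a a≤b)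
  where
  mono : ∀ {c d} → c ≤ℝ d → d ≤ℝ c → ∣ c ∣ℝ ≤ℝ ∣ d ∣ℝ
  mono c≤d d≤c = mk≤ λ where
    (inj₁ Lc) → inj₁ (L⊆L c≤d Lc)
    (inj₂ Uc) → inj₂ (U-antitone d≤c Uc)

------------------------------------------------------------------------
-- Finite sets of reals: a list stands for the set of its members, so
-- order and repetitions are irrelevant and equality is _≐_.

open import Data.List.Membership.Setoid ℝ-setoid public using (_∈_)
open import Data.List.Membership.Setoid.Properties using (∈-map⁺; ∈-map⁻; ∈-resp-≈)
open import Data.List.Relation.Binary.Subset.Setoid ℝ-setoid public using (_⊆_)
open import Data.List.Relation.Unary.Unique.Setoid ℝ-setoid public using (Unique)

infix 4 _≐_

record _≐_ (S T : List ℝ) : Set₁ where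
  constructor mk≐
  field
    ≐⇒⊆ : S ⊆ T
    ≐⇒⊇ : T ⊆ S

open _≐_ public

≐-refl : ∀ {S} → S ≐ S
≐-refl = mk≐ id id

≐-sym : ∀ {S T} → S ≐ T → T ≐ S
≐-sym (mk≐ p q) = mk≐ q p

≐-trans : ∀ {S T R} → S ≐ T → T ≐ R → S ≐ R
≐-trans (mk≐ p q) (mk≐ r s) = mk≐ (r ∘ p) (q ∘ s)

HasSize : List ℝ → ℕ → Set₁
HasSize S m = ∃[ T ] Unique T × length T ≡ m × T ≐ S

infixl 9 _†

_† : List ℝ → List ℝ
S † = map ∣_∣ℝ S

†-mono : ∀ S T → S ⊆ T → S † ⊆ T †
†-mono S T S⊆T b∈S† with ∈-map⁻ ℝ-setoid ℝ-setoid b∈S†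
... | a , a∈S , b≈∣a∣ =
  ∈-resp-≈ ℝ-setoid (Setoid.sym ℝ-setoid b≈∣a∣)
    (∈-map⁺ ℝ-setoid ℝ-setoid ∣∣ℝ-cong (S⊆T a∈S))

------------------------------------------------------------------------

record SimpleGraph (c ℓ e : Level) : Set (suc (c ⊔ ℓ ⊔ e)) where
  field
    vertices : Setoid c ℓ
  open Setoid vertices public using (_≈_) renaming (Carrier to Vertex)
  field
    Adj       : Rel Vertex e
    symmetric : Symmetric Adj
    loopless  : Irreflexive _≈_ Adj
    respects  : Adj Respects₂ _≈_

-- A cycle v₀ v₁ … vₗ v₀ on suc l ≥ 3 pairwise distinct vertices.
record CycleOnSuc {c ℓ e} (G : SimpleGraph c ℓ e) (l : ℕ) : Set (c ⊔ ℓ ⊔ e) where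
  open SimpleGraph G
  field
    long     : 3 ℕ.≤ ℕ.suc l
    v        : Fin (ℕ.suc l) → Vertex
    distinct : Injective _≡_ _≈_ v
    step     : ∀ (i : Fin l) → Adj (v (inject₁ i)) (v (fsuc i))
    close    : Adj (v (fromℕ l)) (v zero)

HasCycleOfLength : ∀ {c ℓ e} → SimpleGraph c ℓ e → ℕ → Set (c ⊔ ℓ ⊔ e)
HasCycleOfLength G m = ∃[ l ] m ≡ ℕ.suc l × CycleOnSuc G l

HasGirth : ∀ {c ℓ e} → SimpleGraph c ℓ e → ℕ → Set (c ⊔ ℓ ⊔ e)
HasGirth G g = HasCycleOfLength G g × (∀ m → HasCycleOfLength G m → g ℕ.≤ m)

------------------------------------------------------------------------
-- The numbers x₁ < … < xₙ are indexed from zero, so xₙ is x i for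
-- suc (toℕ i) ≡ n; this is why 𝓑 below asks for suc (toℕ i) < n.

module KneserB {n : ℕ} (k : ℕ) (x : Fin n → ℝ) where

  𝓑⁺ : ℝ → Set
  𝓑⁺ a = ∃[ i ] a ≈ℝ x i

  𝓑 : ℝ → Set
  𝓑 a = 𝓑⁺ a ⊎ (∃[ i ] ℕ.suc (toℕ i) ℕ.< n × a ≈ℝ -ℝ (x i))

  record φ𝓑 (S : List ℝ) : Set₁ where
    field
      subset       : ∀ {a} → a ∈ S → 𝓑 a
      nonempty     : ∃[ a ] a ∈ S
      distinct-abs : ∀ {a b} → a ∈ S → b ∈ S → ¬ a ≈ℝ b → ¬ ∣ a ∣ℝ ≈ℝ ∣ b ∣ℝ
      positive-max : ∃[ a ] a ∈ S × (∀ {b} → b ∈ S → ∣ b ∣ℝ ≤ℝ ∣ a ∣ℝ) × 0ℝ <ℝ a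

  V₁ : List ℝ → Set₁
  V₁ S = (∀ {a} → a ∈ S → 𝓑⁺ a) × HasSize S k

  V₂ : List ℝ → Set₁
  V₂ S = φ𝓑 S × ¬ V₁ S

  Joined : List ℝ → List ℝ → Set₁
  Joined X Y = V₁ X × V₂ Y × (X ⊆ Y † ⊎ Y † ⊆ X)

  V₁-resp : ∀ {S T} → S ≐ T → V₁ S → V₁ T
  V₁-resp S≐T (sub , R , uniq , len , R≐S) =
    (λ {_} a∈T → sub (≐⇒⊇ S≐T a∈T)) , R , uniq , len , ≐-trans R≐S S≐T

  V₂-resp : ∀ {S T} → S ≐ T → V₂ S → V₂ T
  V₂-resp S≐T@(mk≐ S⊆T T⊆S) (φS , ¬V₁S) = record
    { subset       = λ a∈T → subset (T⊆S a∈T)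
    ; nonempty     = let (a , a∈S) = nonempty in a , S⊆T a∈S
    ; distinct-abs = λ a∈T b∈T → distinct-abs (T⊆S a∈T) (T⊆S b∈T)
    ; positive-max = let (a , a∈S , max , pos) = positive-max in
                     a , S⊆T a∈S , (λ {_} b∈T → max (T⊆S b∈T)) , pos
    } , ¬V₁S ∘ V₁-resp (≐-sym S≐T)
    where open φ𝓑 φS

  Joined-resp : ∀ {X X′ Y Y′} → X ≐ X′ → Y ≐ Y′ → Joined X Y → Joined X′ Y′
  Joined-resp {X} {X′} {Y} {Y′} X≐X′@(mk≐ X⊆X′ X′⊆X) Y≐Y′@(mk≐ Y⊆Y′ Y′⊆Y) (v₁ , v₂ , inc) =
    V₁-resp X≐X′ v₁ , V₂-resp Y≐Y′ v₂ , inc′ inc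
    where
    inc′ : X ⊆ Y † ⊎ Y † ⊆ X → X′ ⊆ Y′ † ⊎ Y′ † ⊆ X′
    inc′ (inj₁ X⊆Y†) = inj₁ (†-mono Y Y′ Y⊆Y′ ∘ X⊆Y† ∘ X′⊆X)
    inc′ (inj₂ Y†⊆X) = inj₂ (X⊆X′ ∘ Y†⊆X ∘ †-mono Y′ Y Y′⊆Y)

  vertexSetoid : Setoid (suc 0ℓ) (suc 0ℓ)
  vertexSetoid = record
    { Carrier       = Σ (List ℝ) (λ S → V₁ S ⊎ V₂ S)
    ; _≈_           = λ (S , _) (T , _) → S ≐ T
    ; isEquivalence = record
      { refl  = ≐-refl
      ; sym   = ≐-sym
      ; trans = ≐-trans
      }
    }

  H-B : SimpleGraph (suc 0ℓ) (suc 0ℓ) (suc 0ℓ)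
  H-B = record
    { vertices  = vertexSetoid
    ; Adj       = λ (S , _) (T , _) → Joined S T ⊎ Joined T S
    ; symmetric = swap
    ; loopless  = λ where
        S≐T (inj₁ (v₁ , (_ , ¬v₁) , _)) → ¬v₁ (V₁-resp S≐T v₁)
        S≐T (inj₂ (v₁ , (_ , ¬v₁) , _)) → ¬v₁ (V₁-resp (≐-sym S≐T) v₁)
    ; respects  =
        (λ where T≐T′ (inj₁ j) → inj₁ (Joined-resp ≐-refl T≐T′ j)
                 T≐T′ (inj₂ j) → inj₂ (Joined-resp T≐T′ ≐-refl j))
      , (λ where S≐S′ (inj₁ j) → inj₁ (Joined-resp S≐S′ ≐-refl j)
                 S≐S′ (inj₂ j) → inj₂ (Joined-resp ≐-refl S≐S′ j))
    }

open KneserB public using (H-B)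

{-# OPTIONS --safe #-}

-- Let X and X′ be two different k-subsets of {x₁, …, xₙ} that both contain
-- x₁.  Both are adjacent to {x₁}, which lies in V₂ because k > 1, and to
-- {x₁, …, xₙ}, which lies in V₂ because k < n; this gives a 4-cycle.  Every
-- edge joins V₁ to its complement V₂, so there is no triangle.

module Submission where

open import Defs
open import Data.Nat using (ℕ; _≤_; _<_)
open import Data.Fin using (Fin) renaming (_<_ to _<ᶠ_)

open import Data.Fin using (zero; suc; fromℕ; inject₁; inject≤; punchIn) renaming (_≤_ to _≤ᶠ_)
import Data.Fin.Properties as Fin
open import Data.List using (List; []; _∷_; length; tabulate)
open import Data.List.Membership.Setoid.Properties
  using (∈-map⁺; ∈-map⁻; ∈-resp-≈; ∈-tabulate⁺; ∈-tabulate⁻; index-injective)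
open import Data.List.Properties using (length-tabulate)
open import Data.List.Relation.Unary.All using () renaming (_∷_ to _∷ᴬ_)
open import Data.List.Relation.Unary.AllPairs using () renaming (_∷_ to _∷ᴾ_)
open import Data.List.Relation.Unary.Any using (here; there; index)
open import Data.List.Relation.Unary.Unique.Setoid.Properties using (tabulate⁺)
open import Data.Nat using (suc; s≤s; z≤n)
open import Data.Nat.Properties using (<⇒≱)
open import Data.Product using (∃-syntax; _,_)
open import Data.Rational.Properties using (≤-total; neg-antimono-≤)
  renaming (≤-trans to ≤ℚ-trans; <⇒≤ to <ℚ⇒≤ℚ)
open import Data.Sum using (inj₁; inj₂)
open import Function using (_∘_; id; const)
open import Function.Definitions using (Injective)
open import Relation.Binary using (Setoid; tri<; tri≈; tri>)
open import Relation.Binary.PropositionalEquality using (_≡_; refl; sym)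
open import Relation.Nullary using (¬_; contradiction)

open ℝ
open Setoid ℝ-setoid using () renaming (sym to ≈ℝ-sym; trans to ≈ℝ-trans)

-- Order, absolute values and finite lists of Dedekind reals.

<ℝ⇒≤ℝ : ∀ {a b} → a <ℝ b → a ≤ℝ b
<ℝ⇒≤ℝ {a} {b} (q , Uaq , Lbq) = mk≤ below
  where
  below : ∀ {p} → L a p → L b p
  below {p} Lap with ≤-total p q
  ... | inj₁ p≤q = L-closed b p≤q Lbq
  ... | inj₂ q≤p = contradiction (U-closed a q≤p Uaq) (disjoint a Lap)

<ℝ⇒≱ℝ : ∀ {a b} → a <ℝ b → ¬ b ≤ℝ a
<ℝ⇒≱ℝ {a} (q , Uaq , Lbq) b≤a = disjoint a (L⊆L b≤a Lbq) Uaq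

<ℝ-≤ℝ-trans : ∀ {a b c} → a <ℝ b → b ≤ℝ c → a <ℝ c
<ℝ-≤ℝ-trans (q , Uaq , Lbq) b≤c = q , Uaq , L⊆L b≤c Lbq

-- Only rationals p below -a need an argument. Take q with 0 < q < a. If p ≤ 0, then p ≤ q, so p is
-- below a; if p ≥ 0, then -p ≤ q puts q above a, which is absurd.
0<a⇒∣a∣≈a : ∀ {a} → 0ℝ <ℝ a → ∣ a ∣ℝ ≈ℝ a
0<a⇒∣a∣≈a {a} (q , 0<q , Laq) = antisym (mk≤ below) (mk≤ inj₁)
  where
  below : ∀ {p} → L ∣ a ∣ℝ p → L a p
  below     (inj₁ Lap)  = Lap
  below {p} (inj₂ Ua-p) with ≤-total p _
  ... | inj₁ p≤0 = L-closed a (≤ℚ-trans p≤0 (<ℚ⇒≤ℚ 0<q)) Laq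
  ... | inj₂ 0≤p = contradiction
    (U-closed a (≤ℚ-trans (neg-antimono-≤ 0≤p) (<ℚ⇒≤ℚ 0<q)) Ua-p)
    (disjoint a Laq)

†-positive : ∀ {S} → (∀ {a} → a ∈ S → 0ℝ <ℝ a) → S † ≐ S
†-positive {S} 0<S = mk≐ to from
  where
  to : S † ⊆ S
  to b∈S† with ∈-map⁻ ℝ-setoid ℝ-setoid b∈S†
  ... | a , a∈S , b≈∣a∣ =
    ∈-resp-≈ ℝ-setoid (≈ℝ-sym (≈ℝ-trans b≈∣a∣ (0<a⇒∣a∣≈a (0<S a∈S)))) a∈S

  from : S ⊆ S †
  from a∈S = ∈-resp-≈ ℝ-setoid (0<a⇒∣a∣≈a (0<S a∈S)) (∈-map⁺ ℝ-setoid ℝ-setoid ∣∣ℝ-cong a∈S)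

-- Pigeonhole: sending i to the position of `f i` in `T` is injective, since entries found at the
-- same position are equal reals.
tabulate-⊆⇒≤ : ∀ {m} {f : Fin m → ℝ} {T} → Injective _≡_ _≈ℝ_ f →
               tabulate f ⊆ T → m ≤ length T
tabulate-⊆⇒≤ f-inj f⊆T = Fin.injective⇒≤
  (f-inj ∘ index-injective ℝ-setoid (f⊆T (∈-tabulate⁺ ℝ-setoid _)) (f⊆T (∈-tabulate⁺ ℝ-setoid _)))

-- Cycles of length three and four.

module _ {c ℓ e} (G : SimpleGraph c ℓ e) where
  open SimpleGraph G

  -- Adjacent vertices differ by looplessness, so distinctness is assumed only for the two
  -- diagonals.
  fourCycle : ∀ {a b c d} → Adj a b → Adj b c → Adj c d → Adj d a →
              ¬ a ≈ c → ¬ b ≈ d → HasCycleOfLength G 4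
  fourCycle {a} {b} {c} {d} ab bc cd da a≉c b≉d = 3 , refl , record
    { long     = s≤s (s≤s (s≤s z≤n))
    ; v        = v
    ; distinct = distinct _ _
    ; step     = step
    ; close    = da
    }
    where
    v : Fin 4 → Vertex
    v zero                   = a
    v (suc zero)             = b
    v (suc (suc zero))       = c
    v (suc (suc (suc zero))) = d

    step : ∀ i → Adj (v (inject₁ i)) (v (suc i))
    step zero             = ab
    step (suc zero)       = bc
    step (suc (suc zero)) = cd

    ≈-sym : ∀ {u w} → u ≈ w → w ≈ u
    ≈-sym = Setoid.sym vertices

    Adj⇒≉ : ∀ {u w} → Adj u w → ¬ u ≈ w
    Adj⇒≉ uw u≈w = loopless u≈w uw

    distinct : ∀ i j → v i ≈ v j → i ≡ j
    distinct zero                   zero                   _ = refl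
    distinct (suc zero)             (suc zero)             _ = refl
    distinct (suc (suc zero))       (suc (suc zero))       _ = refl
    distinct (suc (suc (suc zero))) (suc (suc (suc zero))) _ = refl
    distinct zero                   (suc zero)             p = contradiction p (Adj⇒≉ ab)
    distinct zero                   (suc (suc zero))       p = contradiction p a≉c
    distinct zero                   (suc (suc (suc zero))) p = contradiction (≈-sym p) (Adj⇒≉ da)
    distinct (suc zero)             zero                   p = contradiction (≈-sym p) (Adj⇒≉ ab)
    distinct (suc zero)             (suc (suc zero))       p = contradiction p (Adj⇒≉ bc)
    distinct (suc zero)             (suc (suc (suc zero))) p = contradiction p b≉d
    distinct (suc (suc zero))       zero                   p = contradiction (≈-sym p) a≉c
    distinct (suc (suc zero))       (suc zero)             p = contradiction (≈-sym p) (Adj⇒≉ bc)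
    distinct (suc (suc zero))       (suc (suc (suc zero))) p = contradiction p (Adj⇒≉ cd)
    distinct (suc (suc (suc zero))) zero                   p = contradiction p (Adj⇒≉ da)
    distinct (suc (suc (suc zero))) (suc zero)             p = contradiction (≈-sym p) b≉d
    distinct (suc (suc (suc zero))) (suc (suc zero))       p = contradiction (≈-sym p) (Adj⇒≉ cd)

  -- Cycles have length at least 3 by definition, so only length 3, the case `l` = 2, has to be
  -- excluded.
  triangleFree⇒4≤ : (∀ a b c → Adj a b → Adj b c → ¬ Adj c a) →
                    ∀ m → HasCycleOfLength G m → 4 ≤ m
  triangleFree⇒4≤ noTriangle _ (l , refl , cycle) = longer l v long step close
    where
    open CycleOnSuc cycle

    longer : ∀ l (v : Fin (suc l) → Vertex) → 3 ≤ suc l →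
             (∀ i → Adj (v (inject₁ i)) (v (suc i))) →
             Adj (v (fromℕ l)) (v zero) → 4 ≤ suc l
    longer 0 _ (s≤s ())
    longer 1 _ (s≤s (s≤s ()))
    longer 2 _ _ step close =
      contradiction close (noTriangle _ _ _ (step zero) (step (suc zero)))
    longer (suc (suc (suc _))) _ _ _ _ = s≤s (s≤s (s≤s (s≤s z≤n)))

-- Each edge puts one end in `V₁` and the other in `V₂`. However the three edges are oriented, some
-- vertex falls into both.
H-B-triangleFree : ∀ {n} k (x : Fin n → ℝ) → let open SimpleGraph (H-B k x) in
                   ∀ A B C → Adj A B → Adj B C → ¬ Adj C A
H-B-triangleFree k x _ _ _ (inj₁ (_ , (_ , ¬B) , _)) (inj₁ (B , _))            _                         = ¬B B
H-B-triangleFree k x _ _ _ (inj₂ (B , _))            (inj₂ (_ , (_ , ¬B) , _)) _                         = ¬B B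
H-B-triangleFree k x _ _ _ (inj₁ (A , _))            (inj₂ _)                  (inj₁ (_ , (_ , ¬A) , _)) = ¬A A
H-B-triangleFree k x _ _ _ (inj₁ _)                  (inj₂ (C , _))            (inj₂ (_ , (_ , ¬C) , _)) = ¬C C
H-B-triangleFree k x _ _ _ (inj₂ _)                  (inj₁ (_ , (_ , ¬C) , _)) (inj₁ (C , _))            = ¬C C
H-B-triangleFree k x _ _ _ (inj₂ (_ , (_ , ¬A) , _)) (inj₁ _)                  (inj₂ (A , _))            = ¬A A

-- Sets of positive elements as images of index maps.

module Increasing {n} (x : Fin n → ℝ) (x-pos : ∀ i → 0ℝ <ℝ x i)
         (x-mono-< : ∀ i j → i <ᶠ j → x i <ℝ x j) where

  x-injective : Injective _≡_ _≈ℝ_ x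
  x-injective {i} {j} (antisym xi≤xj xj≤xi) with Fin.<-cmp i j
  ... | tri< i<j _ _ = contradiction xj≤xi (<ℝ⇒≱ℝ (x-mono-< i j i<j))
  ... | tri≈ _ i≡j _ = i≡j
  ... | tri> _ _ j<i = contradiction xi≤xj (<ℝ⇒≱ℝ (x-mono-< j i j<i))

  x-mono-≤ : ∀ {i j} → i ≤ᶠ j → x i ≤ℝ x j
  x-mono-≤ {i} {j} i≤j with Fin.<-cmp i j
  ... | tri< i<j _ _  = <ℝ⇒≤ℝ (x-mono-< i j i<j)
  ... | tri≈ _ refl _ = ≤ℝ-refl
  ... | tri> _ _ j<i  = contradiction i≤j (<⇒≱ j<i)

  module _ {m} (f : Fin m → Fin n) where

    -- Working with indices reduces questions about size and maximum to injectivity and order in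
    -- `Fin n`.
    image : List ℝ
    image = tabulate (x ∘ f)

    ∈-image⁺ : ∀ i → x (f i) ∈ image
    ∈-image⁺ = ∈-tabulate⁺ ℝ-setoid

    ∈-image⁻ : ∀ {a} → a ∈ image → ∃[ i ] a ≈ℝ x (f i)
    ∈-image⁻ = ∈-tabulate⁻ ℝ-setoid

    image-pos : ∀ {a} → a ∈ image → 0ℝ <ℝ a
    image-pos a∈ with ∈-image⁻ a∈
    ... | i , antisym _ xi≤a = <ℝ-≤ℝ-trans {0ℝ} (x-pos (f i)) xi≤a

    image-†⊆ : image † ⊆ image
    image-†⊆ = ≐⇒⊆ (†-positive image-pos)

    image-⊆† : image ⊆ image †
    image-⊆† = ≐⇒⊇ (†-positive image-pos)

    image-𝓑⁺ : ∀ k {a} → a ∈ image → KneserB.𝓑⁺ k x a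
    image-𝓑⁺ _ a∈ with ∈-image⁻ a∈
    ... | i , a≈ = f i , a≈

    -- All elements are positive, hence equal to their absolute values, and the one with the largest
    -- index is the largest.
    image-φ𝓑 : ∀ k top → (∀ i → f i ≤ᶠ f top) → KneserB.φ𝓑 k x image
    image-φ𝓑 k top f≤top = record
      { subset       = inj₁ ∘ image-𝓑⁺ k
      ; nonempty     = x (f top) , ∈-image⁺ top
      ; distinct-abs = λ a∈ b∈ a≉b ∣a∣≈∣b∣ → a≉b
          (≈ℝ-trans (≈ℝ-sym (0<a⇒∣a∣≈a (image-pos a∈)))
            (≈ℝ-trans ∣a∣≈∣b∣ (0<a⇒∣a∣≈a (image-pos b∈))))
      ; positive-max = x (f top) , ∈-image⁺ top , max , x-pos (f top)
      }
      where
      max : ∀ {b} → b ∈ image → ∣ b ∣ℝ ≤ℝ ∣ x (f top) ∣ℝ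
      max b∈ with ∈-image⁻ b∈
      ... | i , b≈ =
        ≤ℝ-trans (≈⇒≤ (≈ℝ-trans (0<a⇒∣a∣≈a (image-pos b∈)) b≈))
          (≤ℝ-trans (x-mono-≤ (f≤top i)) (≈⇒≥ (0<a⇒∣a∣≈a (x-pos (f top)))))

    -- For injective `f` the list `image` is its own repetition-free listing.
    image-V₁ : Injective _≡_ _≡_ f → KneserB.V₁ m x image
    image-V₁ f-inj =
      image-𝓑⁺ m , image , tabulate⁺ ℝ-setoid (f-inj ∘ x-injective) , length-tabulate _ , ≐-refl

-- Sets that do not have size k, and the 4-cycle.

¬HasSize-tooLarge : ∀ {m k} {f : Fin m → ℝ} → Injective _≡_ _≈ℝ_ f → k < m →
                    ¬ HasSize (tabulate f) k
¬HasSize-tooLarge f-inj k<m (T , _ , refl , T≐S) = <⇒≱ k<m (tabulate-⊆⇒≤ f-inj (≐⇒⊇ T≐S))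

-- A listing of length k > 1 has two unequal first entries, yet both would equal `a`.
¬HasSize-singleton : ∀ {a k} → 1 < k → ¬ HasSize (a ∷ []) k
¬HasSize-singleton (s≤s ()) (_ ∷ [] , _ , refl , _)
¬HasSize-singleton _ (_ ∷ _ ∷ _ , (s≉t ∷ᴬ _) ∷ᴾ _ , _ , T≐S)
  with ≐⇒⊆ T≐S (here (Setoid.refl ℝ-setoid)) | ≐⇒⊆ T≐S (there (here (Setoid.refl ℝ-setoid)))
... | here s≈a | here t≈a = s≉t (≈ℝ-trans s≈a (≈ℝ-sym t≈a))

mainTheorem8 : (n k : ℕ) → 3 ≤ n → 1 < k → k < n →
    (x : Fin n → ℝ) → (∀ i → 0ℝ <ℝ x i) → (∀ i j → i <ᶠ j → x i <ℝ x j) →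
    HasGirth (H-B k x) 4
-- Peeling one successor off `k<n` gives `k≤n-1`: k indices fit among those that remain after one is
-- left out.
mainTheorem8 (suc (suc (suc n))) k@(suc (suc _)) (s≤s (s≤s (s≤s z≤n)))
             1<k@(s≤s (s≤s z≤n)) k<n@(s≤s k≤n-1) x x-pos x-mono =
  fourCycle (H-B k x) {a = X} {b = bottom} {c = X′} {d = top}
    (inj₁ (XV₁ , bottomV₂ , inj₂ (bottom⊆ two)))
    (inj₂ (X′V₁ , bottomV₂ , inj₂ (bottom⊆ one)))
    (inj₁ (X′V₁ , topV₂ , inj₁ (⊆top one)))
    (inj₂ (XV₁ , topV₂ , inj₁ (⊆top two)))
    X≉X′ bottom≉top
  , triangleFree⇒4≤ (H-B k x) (H-B-triangleFree k x)
  where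
  open KneserB k x using (V₁; V₂)
  open SimpleGraph (H-B k x) using (Vertex; _≈_)
  open Increasing x x-pos x-mono

  -- The names give the index that `omit` skips, which is one more than the value.
  one two : Fin (suc (suc n))
  one = zero
  two = suc zero

  -- Leaving out suc p rather than p keeps index 0, the element of bottom.
  omit : Fin (suc (suc n)) → Fin k → Fin (suc (suc (suc n)))
  omit p i = punchIn (suc p) (inject≤ i k≤n-1)

  omitV₁ : ∀ p → V₁ (image (omit p))
  omitV₁ p = image-V₁ (omit p)
    (Fin.inject≤-injective _ _ _ _ ∘ Fin.punchIn-injective (suc p) _ _)

  XV₁ : V₁ (image (omit two))
  XV₁ = omitV₁ two

  X′V₁ : V₁ (image (omit one))
  X′V₁ = omitV₁ one

  bottomV₂ : V₂ (image {1} (const zero))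
  bottomV₂ = image-φ𝓑 (const zero) k zero (λ _ → z≤n)
           , λ (_ , size) → ¬HasSize-singleton 1<k size

  topV₂ : V₂ (image id)
  topV₂ = image-φ𝓑 id k (fromℕ _) Fin.≤fromℕ
        , λ (_ , size) → ¬HasSize-tooLarge x-injective k<n size

  X X′ bottom top : Vertex
  X      = image (omit two) , inj₁ XV₁
  X′     = image (omit one) , inj₁ X′V₁
  bottom = image {1} (const zero) , inj₂ bottomV₂
  top    = image id , inj₂ topV₂

  bottom⊆ : ∀ p → image {1} (const zero) † ⊆ image (omit p)
  bottom⊆ p a∈ with image-†⊆ {1} (const zero) a∈
  -- `omit p zero` computes to `zero`, so both lists have head `x zero`.
  ... | here a≈x₀ = here a≈x₀

  ⊆top : ∀ p → image (omit p) ⊆ image id †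
  ⊆top p a∈ with ∈-image⁻ (omit p) a∈
  ... | i , a≈ = image-⊆† id
    (∈-resp-≈ ℝ-setoid (≈ℝ-sym a≈) (∈-image⁺ id (omit p i)))

  X≉X′ : ¬ X ≈ X′
  -- The second entry of `X`, present because k > 1, has index 1, exactly the index that `omit one`
  -- skips.
  X≉X′ X≐X′ with ∈-image⁻ (omit one) (≐⇒⊆ X≐X′ (∈-image⁺ (omit two) (suc zero)))
  ... | i , x₁≈ = Fin.punchInᵢ≢i (suc one) (inject≤ i k≤n-1)
    (sym (x-injective x₁≈))

  bottom≉top : ¬ bottom ≈ top
  bottom≉top bottom≐top with ≐⇒⊇ bottom≐top (∈-image⁺ id (suc zero))
  ... | here x₁≈x₀ with x-injective x₁≈x₀
  ...   | ()
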